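{- In $\mathbf{MLM_{acc}}$: for any $\beta:\mathbb{V}$, if $\beta$ is transitive (i.e. $\Pi_{(x:\overline{\beta})}\Pi_{(y:\overline{\mathsf{pred}\,\beta\,x})}\,\mathsf{pred}(\mathsf{pred}\,\beta\,x)\,y\in\beta$ is inhabited), then for any $\alpha:\mathbb{V}$ and any $t:\mathrm{Acc}\,\alpha$ we have $\Pi_{(\gamma:\mathbb{V})}(\gamma\in\beta\to\gamma\in\mathbf{V}^{\alpha,t}_{\beta})$.
   Context: $\mathbf{MLM_{acc}}$ is intensional Martin-Löf type theory ($\Pi,\Sigma,+,\mathrm{N},\mathrm{N}_n,\mathrm{W}$, intensional identity types) with Setzer's Mahlo universe and an accessibility predicate. Mahlo universe: a type $\mathbb{M}$ with decoding $\mathrm{T}_{\mathbb{M}}$, closed under codes $\widehat{\mathrm{N}}_{\mathbb{M}},\widehat{\mathrm{N}_n}_{\mathbb{M}},\widehat{\Pi}_{\mathbb{M}},\widehat{\Sigma}_{\mathbb{M}},\widehat{+}_{\mathbb{M}},\widehat{\mathrm{W}}_{\mathbb{M}},\widehat{\mathrm{Id}}_{\mathbb{M}}$. $\mathrm{Fam}(\mathbb{M}):=\Sigma_{(x:\mathbb{M})}(\mathrm{T}_{\mathbb{M}}(x)\to\mathbb{M})$. For every $f:\mathrm{Fam}(\mathbb{M})\to\mathrm{Fam}(\mathbb{M})$ there is $\widehat{\mathrm{U}}_f:\mathbb{M}$, $\mathrm{U}_f:=\mathrm{T}_{\mathbb{M}}(\widehat{\mathrm{U}}_f)$, $\widehat{\mathrm{T}}_f:\mathrm{U}_f\to\mathbb{M}$,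 $\mathrm{U}_f$ closed under codes for the standard type formers and under $\mathrm{res}^0_f(a,b),\mathrm{res}^1_f(a,b,c):\mathrm{U}_f$ with $\widehat{\mathrm{T}}_f(\mathrm{res}^0_f(a,b))=\mathsf{p}_1(f(\widehat{\mathrm{T}}_f a,\lambda x.\widehat{\mathrm{T}}_f(b\,x)))$, $\widehat{\mathrm{T}}_f(\mathrm{res}^1_f(a,b,c))=\mathsf{p}_2(f(\widehat{\mathrm{T}}_f a,\lambda x.\widehat{\mathrm{T}}_f(b\,x)))\,c$. $\mathbb{V}:=\mathrm{W}_{(x:\mathbb{M})}\mathrm{T}_{\mathbb{M}}(x)$ with projections $\mathsf{index},\mathsf{pred}$, $\overline{\alpha}:=\mathrm{T}_{\mathbb{M}}(\mathsf{index}\,\alpha)$; $\mathsf{sup}(a,f)\doteq\mathsf{sup}(b,g):=(\Pi_x\Sigma_y f\,x\doteq g\,y)\times(\Pi_y\Sigma_x f\,x\doteq g\,y)$; $\alpha\in\beta:=\Sigma_{(x:\overline{\beta})}\alpha\doteq\mathsf{pred}\,\beta\,x$. $\bigcup\mathsf{sup}(a,f):=\mathsf{sup}(\widehat{\Sigma}_{\mathbb{M}}(a,\lambda x.\mathsf{index}(f\,x)),\lambda(x,y).\mathsf{pred}(f\,x)\,y)$, $\mathsf{sup}(a,f)\cup\mathsf{sup}(b,g):=\mathsf{sup}(a\,\widehat{+}_{\mathbb{M}}b,[f,g])$, $\mathsf{tc}(\mathsf{sup}(a,f)):=\mathsf{sup}(a,f)\cup\bigcup\mathsf{sup}(a,\lambda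 x.\mathsf{tc}(f\,x))$. $\mathrm{Acc}\,\alpha$ is inductively generated by $\mathsf{prog}\,f:\mathrm{Acc}\,\alpha$ for $f:\Pi_{(x:\overline{\mathsf{tc}(\alpha)})}\mathrm{Acc}(\mathsf{pred}\,\mathsf{tc}(\alpha)\,x)$, with dependent elimination. $\mathrm{O}:=\mathrm{Fam}(\mathbb{M})\to\mathrm{Fam}(\mathbb{M})$; $\mathrm{u}^{\mathbb{M}}(z,v)(x,y):=(\widehat{\mathrm{U}}_F,\widehat{\mathrm{T}}_F)$ for $z:\mathbb{M}$, $v:\mathrm{T}_{\mathbb{M}}z\to\mathrm{O}$, $(x,y):\mathrm{Fam}(\mathbb{M})$, where $F:=\lambda w.(\widehat{\mathrm{N}_1}_{\mathbb{M}}\widehat{+}_{\mathbb{M}}x\,\widehat{+}_{\mathbb{M}}z\,\widehat{+}_{\mathbb{M}}\widehat{\Sigma}_{\mathbb{M}}(z,\lambda w'.\mathsf{p}_1(v\,w'\,w)),h^{\mathbb{M}}w)$ and $h^{\mathbb{M}}w$ sends (left-associated sum injections) $\mathsf{iii}\,x_1\mapsto x$, $\mathsf{iij}\,x_2\mapsto y\,x_2$, $\mathsf{ij}\,y_1\mapsto\mathsf{p}_1(v\,y_1\,w)$, $\mathsf{j}(y_1,z_1)\mapsto\mathsf{p}_2(v\,y_1\,w)\,z_1$. $\Phi\,\alpha\,(\mathsf{prog}\,f)(c,h):=\mathrm{u}^{\mathbb{M}}(\mathsf{index}\,\mathsf{tc}(\alpha),\lambda x.\Phi(\mathsf{pred}\,\mathsf{tc}(\alpha)\,x)(f\,x))(c,h)$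 ($\mathrm{Acc}$-recursion). For $\beta:\mathbb{V}$ put $\widehat{\mathcal{U}}^{\alpha,t}_\beta:=\mathsf{p}_1(\Phi\,\alpha\,t\,(\mathsf{index}\,\beta,\lambda x.\mathsf{index}(\mathsf{pred}\,\beta\,x)))$, $\widehat{\mathrm{T}}^{\alpha,t}_\beta:=\mathsf{p}_2(\Phi\,\alpha\,t\,(\mathsf{index}\,\beta,\lambda x.\mathsf{index}(\mathsf{pred}\,\beta\,x)))$, $\widehat{\mathcal{V}}^{\alpha,t}_\beta:=\widehat{\mathrm{W}}_{\mathbb{M}}(\widehat{\mathcal{U}}^{\alpha,t}_\beta,\widehat{\mathrm{T}}^{\alpha,t}_\beta)$, $\mathbf{h}^{\alpha,t}_\beta:\mathrm{T}_{\mathbb{M}}(\widehat{\mathcal{V}}^{\alpha,t}_\beta)\to\mathbb{V}$ with $\mathbf{h}^{\alpha,t}_\beta\mathsf{sup}(b,g):=\mathsf{sup}(\widehat{\mathrm{T}}^{\alpha,t}_\beta(b),\lambda x.\mathbf{h}^{\alpha,t}_\beta(g\,x))$, and $\mathbf{V}^{\alpha,t}_\beta:=\mathsf{sup}(\widehat{\mathcal{V}}^{\alpha,t}_\beta,\mathbf{h}^{\alpha,t}_\beta)$. -}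

module Defs where

open import Data.Nat using (ℕ)
open import Data.Fin using (Fin)
open import Data.Sum using (_⊎_; inj₁; inj₂; [_,_]′)
open import Data.Product using (Σ; _×_; _,_; proj₁; proj₂)
open import Relation.Binary.PropositionalEquality using (_≡_; subst)

data W (A : Set) (B : A → Set) : Set where
  sup : (a : A) → (B a → W A B) → W A B

cast : {A B : Set} → A ≡ B → A → B
cast = subst (λ X → X)

Fam : (M : Set) → (M → Set) → Set
Fam M T = Σ M (λ x → T x → M)

-- Setzer's Mahlo universe.  The decoding equations, which are judgemental in
-- MLM, are represented by propositional equalities.
record Mahlo : Set₁ where
  field
    M : Set
    T : M → Set
    N̂ : M
    T-N : T N̂ ≡ ℕ
    N̂ₙ : ℕ → M
    T-Nₙ : ∀ n → T (N̂ₙ n) ≡ Fin n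
    Π̂ : (a : M) → (T a → M) → M
    T-Π : ∀ a b → T (Π̂ a b) ≡ ((x : T a) → T (b x))
    Σ̂ : (a : M) → (T a → M) → M
    T-Σ : ∀ a b → T (Σ̂ a b) ≡ Σ (T a) (λ x → T (b x))
    _+̂_ : M → M → M
    T-+ : ∀ a b → T (a +̂ b) ≡ (T a ⊎ T b)
    Ŵ : (a : M) → (T a → M) → M
    T-W : ∀ a b → T (Ŵ a b) ≡ W (T a) (λ x → T (b x))
    Îd : (a : M) → T a → T a → M
    T-Id : ∀ a x y → T (Îd a x y) ≡ (x ≡ y)
    Û : (Fam M T → Fam M T) → M
    T̂ : (f : Fam M T → Fam M T) → T (Û f) → M
    N̂ᵤ : ∀ f → T (Û f)
    T̂-N : ∀ f → T̂ f (N̂ᵤ f) ≡ N̂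
    N̂ₙᵤ : ∀ f → ℕ → T (Û f)
    T̂-Nₙ : ∀ f n → T̂ f (N̂ₙᵤ f n) ≡ N̂ₙ n
    Π̂ᵤ : ∀ f (a : T (Û f)) → (T (T̂ f a) → T (Û f)) → T (Û f)
    T̂-Π : ∀ f a b → T̂ f (Π̂ᵤ f a b) ≡ Π̂ (T̂ f a) (λ x → T̂ f (b x))
    Σ̂ᵤ : ∀ f (a : T (Û f)) → (T (T̂ f a) → T (Û f)) → T (Û f)
    T̂-Σ : ∀ f a b → T̂ f (Σ̂ᵤ f a b) ≡ Σ̂ (T̂ f a) (λ x → T̂ f (b x))
    +̂ᵤ : ∀ f → T (Û f) → T (Û f) → T (Û f)
    T̂-+ : ∀ f a b → T̂ f (+̂ᵤ f a b) ≡ (T̂ f a +̂ T̂ f b)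
    Ŵᵤ : ∀ f (a : T (Û f)) → (T (T̂ f a) → T (Û f)) → T (Û f)
    T̂-W : ∀ f a b → T̂ f (Ŵᵤ f a b) ≡ Ŵ (T̂ f a) (λ x → T̂ f (b x))
    Îdᵤ : ∀ f (a : T (Û f)) → T (T̂ f a) → T (T̂ f a) → T (Û f)
    T̂-Id : ∀ f a x y → T̂ f (Îdᵤ f a x y) ≡ Îd (T̂ f a) x y
    res⁰ : ∀ f (a : T (Û f)) → (T (T̂ f a) → T (Û f)) → T (Û f)
    T̂-res⁰ : ∀ f a b → T̂ f (res⁰ f a b) ≡ proj₁ (f (T̂ f a , λ x → T̂ f (b x)))
    res¹ : ∀ f (a : T (Û f)) (b : T (T̂ f a) → T (Û f))
           → T (proj₁ (f (T̂ f a , λ x → T̂ f (b x)))) → T (Û f)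
    T̂-res¹ : ∀ f a b c → T̂ f (res¹ f a b c) ≡ proj₂ (f (T̂ f a , λ x → T̂ f (b x))) c

module MLM (𝕄 : Mahlo) where
  open Mahlo 𝕄 public

  𝕍 : Set
  𝕍 = W M T

  index : 𝕍 → M
  index (sup a f) = a

  pred : (α : 𝕍) → T (index α) → 𝕍
  pred (sup a f) = f

  ‾_ : 𝕍 → Set
  ‾ α = T (index α)

  _≐_ : 𝕍 → 𝕍 → Set
  sup a f ≐ sup b g =
    ((x : T a) → Σ (T b) (λ y → f x ≐ g y)) × ((y : T b) → Σ (T a) (λ x → f x ≐ g y))

  _∈_ : 𝕍 → 𝕍 → Set
  α ∈ β = Σ (‾ β) (λ x → α ≐ pred β x)

  ⋃ : 𝕍 → 𝕍
  ⋃ (sup a f) = sup (Σ̂ a (λ x → index (f x)))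
                    (λ p → pred (f (proj₁ (cast (T-Σ _ _) p))) (proj₂ (cast (T-Σ _ _) p)))

  _∪_ : 𝕍 → 𝕍 → 𝕍
  sup a f ∪ sup b g = sup (a +̂ b) (λ e → [ f , g ]′ (cast (T-+ a b) e))

  tc : 𝕍 → 𝕍
  tc (sup a f) = sup a f ∪ ⋃ (sup a (λ x → tc (f x)))

  data Acc : 𝕍 → Set where
    prog : {α : 𝕍} → ((x : ‾ tc α) → Acc (pred (tc α) x)) → Acc α

  O : Set
  O = Fam M T → Fam M T

  module _ (z : M) (v : T z → O) (x : M) (y : T x → M) where
    Fcode : Fam M T → M
    Fcode w = ((N̂ₙ 1 +̂ x) +̂ z) +̂ Σ̂ z (λ w' → proj₁ (v w' w))

    hᴹ : (w : Fam M T) → T (Fcode w) → M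
    hᴹ w e =
      [ (λ e₁ → [ (λ e₂ → [ (λ x₁ → x) , (λ x₂ → y x₂) ]′ (cast (T-+ _ _) e₂))
                , (λ y₁ → proj₁ (v y₁ w)) ]′ (cast (T-+ _ _) e₁))
      , (λ p → proj₂ (v (proj₁ (cast (T-Σ _ _) p)) w) (proj₂ (cast (T-Σ _ _) p))) ]′
      (cast (T-+ _ _) e)

    F : O
    F w = Fcode w , hᴹ w

  uᴹ : (z : M) → (T z → O) → O
  uᴹ z v (x , y) = Û (F z v x y) , T̂ (F z v x y)

  Φ : (α : 𝕍) → Acc α → O
  Φ α (prog f) = uᴹ (index (tc α)) (λ x → Φ (pred (tc α) x) (f x))

  module _ (α : 𝕍) (t : Acc α) (β : 𝕍) where
    Φβ : Fam M T
    Φβ = Φ α t (index β , λ x → index (pred β x))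

    Û𝒰 : M
    Û𝒰 = proj₁ Φβ

    T̂ᵝ : T Û𝒰 → M
    T̂ᵝ = proj₂ Φβ

    Û𝒱 : M
    Û𝒱 = Ŵ Û𝒰 T̂ᵝ

    hW : W (T Û𝒰) (λ x → T (T̂ᵝ x)) → 𝕍
    hW (sup b g) = sup (T̂ᵝ b) (λ x → hW (g x))

    𝐡 : T Û𝒱 → 𝕍
    𝐡 e = hW (cast (T-W _ _) e)

    𝐕 : 𝕍
    𝐕 = sup Û𝒱 𝐡

  Transitive : 𝕍 → Set
  Transitive β = (x : ‾ β) → (y : ‾ pred β x) → pred (pred β x) y ∈ β

-- The universe Φ α t (index β , index ∘ pred β) contains, through res¹, a code
-- for the index of every element of β.  Hence, by induction on the
-- well-founded tree γ, every γ ∈ β is (up to ≐) the image under 𝐡 of a W-tree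
-- in that universe: the children of γ are again elements of β by
-- transitivity, and the branching of the tree is the decoded index.
module Submission where

open import Defs
open import Data.Sum using (inj₁; inj₂)
open import Data.Product using (Σ; _,_; proj₁; proj₂)
open import Relation.Binary.PropositionalEquality
  using (_≡_; refl; sym; trans; cong; subst)

cast-cast-sym : {A B : Set} (p : A ≡ B) (b : B) → cast p (cast (sym p) b) ≡ b
cast-cast-sym refl b = refl

module _ (𝕄 : Mahlo) where
  open MLM 𝕄

  ≐-sym : (δ ε : 𝕍) → δ ≐ ε → ε ≐ δ
  ≐-sym (sup a f) (sup b g) (forth , back) =
    (λ y → proj₁ (back y) , ≐-sym (f (proj₁ (back y))) (g y) (proj₂ (back y))) ,
    (λ x → proj₁ (forth x) , ≐-sym (f x) (g (proj₁ (forth x))) (proj₂ (forth x)))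

  ≐-trans : (δ ε ζ : 𝕍) → δ ≐ ε → ε ≐ ζ → δ ≐ ζ
  ≐-trans (sup a f) (sup b g) (sup c h) (forth₁ , back₁) (forth₂ , back₂) =
    (λ x → let (y , fx≐gy) = forth₁ x ; (z , gy≐hz) = forth₂ y in
           z , ≐-trans (f x) (g y) (h z) fx≐gy gy≐hz) ,
    (λ z → let (y , gy≐hz) = back₂ z ; (x , fx≐gy) = back₁ y in
           x , ≐-trans (f x) (g y) (h z) fx≐gy gy≐hz)

  ≐-forth : (δ ε : 𝕍) → δ ≐ ε → (i : ‾ δ) → Σ (‾ ε) (λ j → pred δ i ≐ pred ε j)
  ≐-forth (sup a f) (sup b g) (forth , back) = forth

  ≐-back : (δ ε : 𝕍) → δ ≐ ε → (j : ‾ ε) → Σ (‾ δ) (λ i → pred δ i ≐ pred ε j)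
  ≐-back (sup a f) (sup b g) (forth , back) = back

  ∈-resp-≐ : (δ ε β : 𝕍) → δ ≐ ε → ε ∈ β → δ ∈ β
  ∈-resp-≐ δ ε β δ≐ε (x , ε≐βx) = x , ≐-trans δ ε (pred β x) δ≐ε ε≐βx

  inl̂ : {a b : M} → T a → T (a +̂ b)
  inl̂ {a} {b} e = cast (sym (T-+ a b)) (inj₁ e)

  inr̂ : {a b : M} → T b → T (a +̂ b)
  inr̂ {a} {b} e = cast (sym (T-+ a b)) (inj₂ e)

  hᴹ-decodes-family : (z : M) (v : T z → O) (x : M) (y : T x → M) (w : Fam M T)
    (i : T x) → hᴹ z v x y w (inl̂ (inl̂ (inr̂ i))) ≡ y i
  hᴹ-decodes-family z v x y w i
    rewrite cast-cast-sym (T-+ ((N̂ₙ 1 +̂ x) +̂ z) (Σ̂ z (λ w' → proj₁ (v w' w))))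
                          (inj₁ (inl̂ (inr̂ i)))
          | cast-cast-sym (T-+ (N̂ₙ 1 +̂ x) z) (inj₁ (inr̂ i))
          | cast-cast-sym (T-+ (N̂ₙ 1) x) (inj₂ i) = refl

  uᴹ-decodes-family : (z : M) (v : T z → O) (x : M) (y : T x → M) (i : T x) →
    Σ (T (proj₁ (uᴹ z v (x , y)))) (λ c → proj₂ (uᴹ z v (x , y)) c ≡ y i)
  uᴹ-decodes-family z v x y i =
    res¹ F′ a (λ _ → a) (inl̂ (inl̂ (inr̂ i))) ,
    trans (T̂-res¹ F′ a (λ _ → a) _) (hᴹ-decodes-family z v x y _ i)
    where
    F′ : O
    F′ = F z v x y
    -- any code will do as the argument family: hᴹ ignores it on this summand
    a : T (Û F′)
    a = N̂ᵤ F′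

  Φ-decodes-family : (α : 𝕍) (t : Acc α) (x : M) (y : T x → M) (i : T x) →
    Σ (T (proj₁ (Φ α t (x , y)))) (λ c → proj₂ (Φ α t (x , y)) c ≡ y i)
  Φ-decodes-family α (prog f) =
    uᴹ-decodes-family (index (tc α)) (λ x → Φ (pred (tc α) x) (f x))

  module _ (α : 𝕍) (t : Acc α) (β : 𝕍) (β-trans : Transitive β) where

    code : (x : ‾ β) → T (Û𝒰 α t β)
    code x = proj₁ (Φ-decodes-family α t _ _ x)

    decode-code : (x : ‾ β) → T (T̂ᵝ α t β (code x)) ≡ ‾ pred β x
    decode-code x = cong T (proj₂ (Φ-decodes-family α t _ _ x))

    ∈⇒hW-image : (δ : 𝕍) → δ ∈ β →
      Σ (W (T (Û𝒰 α t β)) (λ c → T (T̂ᵝ α t β c))) (λ w → hW α t β w ≐ δ)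
    ∈⇒hW-image (sup a f) (x , δ≐βx) = sup (code x) (λ y → proj₁ (child y)) , forth , back
      where
      δ = sup a f
      βx = pred β x

      toβx : T (T̂ᵝ α t β (code x)) → ‾ βx
      toβx = cast (decode-code x)

      matching : (y : T (T̂ᵝ α t β (code x))) → Σ (T a) (λ i → f i ≐ pred βx (toβx y))
      matching y = ≐-back δ βx δ≐βx (toβx y)

      child : (y : T (T̂ᵝ α t β (code x))) →
        Σ (W (T (Û𝒰 α t β)) (λ c → T (T̂ᵝ α t β c)))
          (λ w → hW α t β w ≐ f (proj₁ (matching y)))
      child y = let (i , fi≐βxy) = matching y in
        ∈⇒hW-image (f i) (∈-resp-≐ (f i) _ β fi≐βxy (β-trans x (toβx y)))

      forth : (y : T (T̂ᵝ α t β (code x))) → Σ (T a) (λ i → hW α t β (proj₁ (child y)) ≐ f i)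
      forth y = proj₁ (matching y) , proj₂ (child y)

      back : (i : T a) → Σ (T (T̂ᵝ α t β (code x))) (λ y → hW α t β (proj₁ (child y)) ≐ f i)
      back i = y , ≐-trans _ _ (f i) (proj₂ (child y))
                     (≐-trans _ (pred βx (toβx y)) (f i) (proj₂ (matching y)) βxy≐fi)
        where
        j = proj₁ (≐-forth δ βx δ≐βx i)
        y = cast (sym (decode-code x)) j
        βxy≐fi : pred βx (toβx y) ≐ f i
        βxy≐fi = subst (λ k → pred βx k ≐ f i) (sym (cast-cast-sym (decode-code x) j))
                   (≐-sym (f i) _ (proj₂ (≐-forth δ βx δ≐βx i)))

    ∈⇒∈𝐕 : (γ : 𝕍) → γ ∈ β → γ ∈ 𝐕 α t β
    ∈⇒∈𝐕 γ γ∈β = cast (sym (T-W _ _)) w , ≐-sym (𝐡 α t β e) γ 𝐡e≐γ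
      where
      w = proj₁ (∈⇒hW-image γ γ∈β)
      e = cast (sym (T-W _ _)) w
      𝐡e≐γ : 𝐡 α t β e ≐ γ
      𝐡e≐γ = subst (λ k → hW α t β k ≐ γ) (sym (cast-cast-sym (T-W _ _) w))
                (proj₂ (∈⇒hW-image γ γ∈β))

lemma3p22 : (𝕄 : Mahlo) → let open MLM 𝕄 in
    (β : 𝕍) → Transitive β → (α : 𝕍) (t : Acc α) (γ : 𝕍) → γ ∈ β → γ ∈ 𝐕 α t β
lemma3p22 𝕄 β β-trans α t = ∈⇒∈𝐕 𝕄 α t β β-trans
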